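{- Consider the translation from $\mathsf{CL}_{\rm b}$ to $\mathsf{CLL}_{\rm b}$ obtained by composing the Kuroda translation $(\cdot)^{\rm Ku}$ with Girard's call-by-name translation $(\cdot)^\circ$, i.e. $A\mapsto(A^{\rm Ku})^\circ$. This composition can be presented directly in a modular (and simpler) way as $A\mapsto\,!?!A_{{\rm Ku}\circ}$, i.e. for every formula $A$ of the language of $\mathsf{ILL}_\bot$ the formulas $(A^{\rm Ku})^\circ$ and $!?!A_{{\rm Ku}\circ}$ are provably equivalent in $\mathsf{CLL}_{\rm b}$, where $A_{{\rm Ku}\circ}$ is defined inductively by: $P_{{\rm Ku}\circ}:=P$ for $P$ atomic; $(A\otimes B)_{{\rm Ku}\circ}:=\,!A_{{\rm Ku}\circ}\otimes\,!B_{{\rm Ku}\circ}$; $(A\& B)_{{\rm Ku}\circ}:=\,!A_{{\rm Ku}\circ}\&\,!B_{{\rm Ku}\circ}$; $(A\oplus B)_{{\rm Ku}\circ}:=\,!A_{{\rm Ku}\circ}\oplus\,!B_{{\rm Ku}\circ}$; $(A\multimap B)_{{\rm Ku}\circ}:=\,!A_{{\rm Ku}\circ}\multimap B_{{\rm Ku}\circ}$; $(\forall xA)_{{\rm Ku}\circ}:=\forall x\,?!A_{{\rm Ku}\circ}$; $(\exists xA)_{{\rm Ku}\circ}:=\exists x\,!A_{{\rm Ku}\circ}$; $(!A)_{{\rm Ku}\circ}:=\,!A_{{\rm Ku}\circ}$.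
   Context: Intuitionistic linear logic $\mathsf{ILL}$ (first order). Formulas are built from atomic formulas, including the constants $1,\top,0$, using $\otimes,\&,\oplus,\multimap$, $\forall x,\exists x$ and $!$. Sequents are $\Gamma\vdash A$ with $\Gamma$ a finite multiset of formulas and exactly one formula on the right. Axioms: $A\vdash A$; $\vdash 1$; $\Gamma\vdash\top$; $\Gamma,0\vdash C$. Rules (premises $\Rightarrow$ conclusion): (cut) $\Gamma\vdash A;\ \Delta,A\vdash C\Rightarrow\Gamma,\Delta\vdash C$; $\Gamma\vdash C\Rightarrow\Gamma,1\vdash C$; $\Gamma\vdash A;\ \Delta\vdash B\Rightarrow\Gamma,\Delta\vdash A\otimes B$; $\Gamma,A,B\vdash C\Rightarrow\Gamma,A\otimes B\vdash C$; $\Gamma,A\vdash B\Rightarrow\Gamma\vdash A\multimap B$; $\Gamma\vdash A;\ \Delta,B\vdash C\Rightarrow\Gamma,\Delta,A\multimap B\vdash C$; $\Gamma\vdash A;\ \Gamma\vdash B\Rightarrow\Gamma\vdash A\& B$; $\Gamma,A\vdash C\Rightarrow\Gamma,A\& B\vdash C$; $\Gamma,B\vdash C\Rightarrow\Gamma,A\& B\vdash C$; $\Gamma\vdash A\Rightarrow\Gamma\vdash A\oplus B$; $\Gamma\vdash B\Rightarrow\Gamma\vdash A\oplus B$; $\Gamma,A\vdash C;\ \Gamma,B\vdash C\Rightarrow\Gamma,A\oplus B\vdash C$; $\Gamma\vdash A\Rightarrow\Gamma\vdash\forall xA$; $\Gamma,A[t/x]\vdash C\Rightarrow\Gamma,\forall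 xA\vdash C$; $\Gamma\vdash A[t/x]\Rightarrow\Gamma\vdash\exists xA$; $\Gamma,A\vdash C\Rightarrow\Gamma,\exists xA\vdash C$ (usual eigenvariable conditions); $\Gamma,!A,!A\vdash C\Rightarrow\Gamma,!A\vdash C$; $\Gamma\vdash C\Rightarrow\Gamma,!A\vdash C$; $!\Gamma\vdash A\Rightarrow\,!\Gamma\vdash\,!A$; $\Gamma,A\vdash C\Rightarrow\Gamma,!A\vdash C$. $\mathsf{ILL}_\bot$ extends $\mathsf{ILL}$ by one more constant $\bot$ (also counted as atomic); its sequents have at most one formula on the right (so $C$ in the rules above may be absent), and it has the additional axiom $\bot\vdash$ and rule $\Gamma\vdash\ \Rightarrow\Gamma\vdash\bot$. $\neg A:=A\multimap\bot$ and $?A:=\neg\,!\,\neg A$. $\mathsf{PRO}$: $A\vdash\,!A$; $\mathsf{DNE}$: $\neg\neg A\vdash A$ (axiom schemas). $\mathsf{CLL}_{\rm b}:=\mathsf{ILL}_\bot+\mathsf{DNE}$; $\mathsf{CL}_{\rm b}:=\mathsf{ILL}_\bot+\mathsf{PRO}+\mathsf{DNE}$. Formulas $A,B$ are provably equivalent in $S$ if $S$ proves $(A\multimap B)\&(B\multimap A)$. Kuroda translation: $A^{\rm Ku}:=\neg\neg A_{\rm Ku}$ where $P_{\rm Ku}:=P$ ($P$ atomic); $(A\,\square\,B)_{\rm Ku}:=A_{\rm Ku}\,\square\,B_{\rm Ku}$ for $\square\in\{\otimes,\&,\oplus,\multimap\}$; $(\forall xA)_{\rm Ku}:=\forall x\,\neg\neg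 A_{\rm Ku}$; $(\exists xA)_{\rm Ku}:=\exists xA_{\rm Ku}$; $(!A)_{\rm Ku}:=\,!A_{\rm Ku}$. Call-by-name translation: $A^\circ:=\,!A_\circ$ where $P_\circ:=P$ ($P$ atomic); $(A\otimes B)_\circ:=\,!A_\circ\otimes\,!B_\circ$; $(A\& B)_\circ:=A_\circ\& B_\circ$; $(A\oplus B)_\circ:=\,!A_\circ\oplus\,!B_\circ$; $(A\multimap B)_\circ:=\,!A_\circ\multimap B_\circ$; $(\forall xA)_\circ:=\forall xA_\circ$; $(\exists xA)_\circ:=\exists x\,!A_\circ$; $(!A)_\circ:=\,!A_\circ$. -}

module Defs where

open import Data.List.Base using (List; []; _∷_; _++_; [_]; map)
open import Data.List.Relation.Binary.Permutation.Propositional using (_↭_)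
open import Data.Maybe.Base as Maybe using (Maybe; just; nothing)
open import Data.Nat.Base using (ℕ; zero; suc)
open import Data.Vec.Base using (Vec; []; _∷_)
open import Function.Base using (_∘_)
open import Relation.Binary.Construct.Union using (_∪_)

record Signature : Set₁ where
  field
    Fun      : Set
    funArity : Fun → ℕ
    Rel      : Set
    relArity : Rel → ℕ

open Signature public

-- Variables are de Bruijn indices.  Terms and formulas are deliberately not
-- indexed by a bound on their free variables: as with named variables, an
-- unlimited supply of free variables is always available, so a term to
-- instantiate a quantifier with exists even over a signature without constants.

data Term (L : Signature) : Set where
  var : ℕ → Term L
  fun : (f : Fun L) → Vec (Term L) (funArity L f) → Term L

data Atom (L : Signature) : Set where
  rel       : (R : Rel L) → Vec (Term L) (relArity L R) → Atom L
  𝟏 ⊤ 𝟎 ⊥ : Atom L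

infixr 8 !_ ？_ ¬_ ∀′_ ∃′_
infixr 7 _⊗_
infixr 6 _&_ _⊕_
infixr 5 _⊸_

data Formula (L : Signature) : Set where
  atom            : Atom L → Formula L
  _⊗_ _&_ _⊕_ _⊸_ : Formula L → Formula L → Formula L
  ∀′_ ∃′_         : Formula L → Formula L
  !_              : Formula L → Formula L

¬_ : ∀ {L} → Formula L → Formula L
¬ A = A ⊸ atom ⊥

-- Fullwidth ？, since ASCII ? is reserved for metavariables.
？_ : ∀ {L} → Formula L → Formula L
？ A = ¬ ! ¬ A

Subst : Signature → Set
Subst L = ℕ → Term L

mutual
  subT : ∀ {L} → Subst L → Term L → Term L
  subT σ (var i)    = σ i
  subT σ (fun f ts) = fun f (subTs σ ts)

  subTs : ∀ {L n} → Subst L → Vec (Term L) n → Vec (Term L) n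
  subTs σ []       = []
  subTs σ (t ∷ ts) = subT σ t ∷ subTs σ ts

subA : ∀ {L} → Subst L → Atom L → Atom L
subA σ (rel R ts) = rel R (subTs σ ts)
subA σ 𝟏          = 𝟏
subA σ ⊤          = ⊤
subA σ 𝟎          = 𝟎
subA σ ⊥          = ⊥

lift : ∀ {L} → Subst L → Subst L
lift σ zero    = var zero
lift σ (suc i) = subT (var ∘ suc) (σ i)

subF : ∀ {L} → Subst L → Formula L → Formula L
subF σ (atom P) = atom (subA σ P)
subF σ (A ⊗ B)  = subF σ A ⊗ subF σ B
subF σ (A & B)  = subF σ A & subF σ B
subF σ (A ⊕ B)  = subF σ A ⊕ subF σ B
subF σ (A ⊸ B)  = subF σ A ⊸ subF σ B
subF σ (∀′ A)   = ∀′ subF (lift σ) A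
subF σ (∃′ A)   = ∃′ subF (lift σ) A
subF σ (! A)    = ! subF σ A

weaken : ∀ {L} → Formula L → Formula L
weaken = subF (var ∘ suc)

single : ∀ {L} → Term L → Subst L
single t zero    = t
single t (suc i) = var i

infix 9 _⟦_⟧
_⟦_⟧ : ∀ {L} → Formula L → Term L → Formula L
A ⟦ t ⟧ = subF (single t) A

-- A set of additional axioms, each of the form A ⊢ B.
AxiomSet : Signature → Set₁
AxiomSet L = Formula L → Formula L → Set

-- T ▷ Γ ⊢ C: the sequent Γ ⊢ C is derivable in ILL⊥ + T.  Multisets are
-- lists with an explicit exchange rule; the right-hand side is empty
-- (nothing) or a single formula.  The eigenvariable of ∀R and ∃L is index 0,
-- which does not occur in the weakened side formulas.

infix 3 _▷_⊢_

data _▷_⊢_ {L : Signature} (T : AxiomSet L) :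
           List (Formula L) → Maybe (Formula L) → Set where
  exch : ∀ {Γ Δ C} → Γ ↭ Δ → T ▷ Γ ⊢ C → T ▷ Δ ⊢ C

  axiom : ∀ {A B} → T A B → T ▷ [ A ] ⊢ just B
  id    : ∀ {A} → T ▷ [ A ] ⊢ just A
  cut   : ∀ {Γ Δ A C} → T ▷ Γ ⊢ just A → T ▷ A ∷ Δ ⊢ C → T ▷ Γ ++ Δ ⊢ C

  𝟏R : T ▷ [] ⊢ just (atom 𝟏)
  𝟏L : ∀ {Γ C} → T ▷ Γ ⊢ C → T ▷ atom 𝟏 ∷ Γ ⊢ C
  ⊤R : ∀ {Γ} → T ▷ Γ ⊢ just (atom ⊤)
  𝟎L : ∀ {Γ C} → T ▷ atom 𝟎 ∷ Γ ⊢ C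
  ⊥L : T ▷ [ atom ⊥ ] ⊢ nothing
  ⊥R : ∀ {Γ} → T ▷ Γ ⊢ nothing → T ▷ Γ ⊢ just (atom ⊥)

  ⊗R  : ∀ {Γ Δ A B} → T ▷ Γ ⊢ just A → T ▷ Δ ⊢ just B → T ▷ Γ ++ Δ ⊢ just (A ⊗ B)
  ⊗L  : ∀ {Γ A B C} → T ▷ A ∷ B ∷ Γ ⊢ C → T ▷ A ⊗ B ∷ Γ ⊢ C
  ⊸R  : ∀ {Γ A B} → T ▷ A ∷ Γ ⊢ just B → T ▷ Γ ⊢ just (A ⊸ B)
  ⊸L  : ∀ {Γ Δ A B C} → T ▷ Γ ⊢ just A → T ▷ B ∷ Δ ⊢ C → T ▷ (A ⊸ B) ∷ Γ ++ Δ ⊢ C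
  &R  : ∀ {Γ A B} → T ▷ Γ ⊢ just A → T ▷ Γ ⊢ just B → T ▷ Γ ⊢ just (A & B)
  &L₁ : ∀ {Γ A B C} → T ▷ A ∷ Γ ⊢ C → T ▷ A & B ∷ Γ ⊢ C
  &L₂ : ∀ {Γ A B C} → T ▷ B ∷ Γ ⊢ C → T ▷ A & B ∷ Γ ⊢ C
  ⊕R₁ : ∀ {Γ A B} → T ▷ Γ ⊢ just A → T ▷ Γ ⊢ just (A ⊕ B)
  ⊕R₂ : ∀ {Γ A B} → T ▷ Γ ⊢ just B → T ▷ Γ ⊢ just (A ⊕ B)
  ⊕L  : ∀ {Γ A B C} → T ▷ A ∷ Γ ⊢ C → T ▷ B ∷ Γ ⊢ C → T ▷ A ⊕ B ∷ Γ ⊢ C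

  ∀R : ∀ {Γ A} → T ▷ map weaken Γ ⊢ just A → T ▷ Γ ⊢ just (∀′ A)
  ∀L : ∀ {Γ A C} (t : Term L) → T ▷ A ⟦ t ⟧ ∷ Γ ⊢ C → T ▷ ∀′ A ∷ Γ ⊢ C
  ∃R : ∀ {Γ A} (t : Term L) → T ▷ Γ ⊢ just (A ⟦ t ⟧) → T ▷ Γ ⊢ just (∃′ A)
  ∃L : ∀ {Γ A C} → T ▷ A ∷ map weaken Γ ⊢ Maybe.map weaken C →
       T ▷ ∃′ A ∷ Γ ⊢ C

  !C : ∀ {Γ A C} → T ▷ ! A ∷ ! A ∷ Γ ⊢ C → T ▷ ! A ∷ Γ ⊢ C
  !W : ∀ {Γ A C} → T ▷ Γ ⊢ C → T ▷ ! A ∷ Γ ⊢ C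
  !R : ∀ {Γ A} → T ▷ map !_ Γ ⊢ just A → T ▷ map !_ Γ ⊢ just (! A)
  !L : ∀ {Γ A C} → T ▷ A ∷ Γ ⊢ C → T ▷ ! A ∷ Γ ⊢ C

data PRO {L : Signature} : AxiomSet L where
  pro : ∀ {A} → PRO A (! A)

data DNE {L : Signature} : AxiomSet L where
  dne : ∀ {A} → DNE (¬ ¬ A) A

CLLb CLb : ∀ {L} → AxiomSet L
CLLb = DNE
CLb  = PRO ∪ DNE

ProvablyEquivalent : ∀ {L} → AxiomSet L → Formula L → Formula L → Set
ProvablyEquivalent T A B = T ▷ [] ⊢ just ((A ⊸ B) & (B ⊸ A))

-- _^X is a translation with its outer prefix, _↓X its inductively defined
-- (subscript) part.

infixl 10 _^Ku _↓Ku _^∘ _↓∘ _↓Ku∘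

_↓Ku : ∀ {L} → Formula L → Formula L
atom P  ↓Ku = atom P
(A ⊗ B) ↓Ku = A ↓Ku ⊗ B ↓Ku
(A & B) ↓Ku = A ↓Ku & B ↓Ku
(A ⊕ B) ↓Ku = A ↓Ku ⊕ B ↓Ku
(A ⊸ B) ↓Ku = A ↓Ku ⊸ B ↓Ku
(∀′ A)  ↓Ku = ∀′ ¬ ¬ A ↓Ku
(∃′ A)  ↓Ku = ∃′ A ↓Ku
(! A)   ↓Ku = ! A ↓Ku

_^Ku : ∀ {L} → Formula L → Formula L
A ^Ku = ¬ ¬ A ↓Ku

_↓∘ : ∀ {L} → Formula L → Formula L
atom P  ↓∘ = atom P
(A ⊗ B) ↓∘ = ! A ↓∘ ⊗ ! B ↓∘
(A & B) ↓∘ = A ↓∘ & B ↓∘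
(A ⊕ B) ↓∘ = ! A ↓∘ ⊕ ! B ↓∘
(A ⊸ B) ↓∘ = ! A ↓∘ ⊸ B ↓∘
(∀′ A)  ↓∘ = ∀′ A ↓∘
(∃′ A)  ↓∘ = ∃′ ! A ↓∘
(! A)   ↓∘ = ! A ↓∘

_^∘ : ∀ {L} → Formula L → Formula L
A ^∘ = ! A ↓∘

_↓Ku∘ : ∀ {L} → Formula L → Formula L
atom P  ↓Ku∘ = atom P
(A ⊗ B) ↓Ku∘ = ! A ↓Ku∘ ⊗ ! B ↓Ku∘
(A & B) ↓Ku∘ = ! A ↓Ku∘ & ! B ↓Ku∘
(A ⊕ B) ↓Ku∘ = ! A ↓Ku∘ ⊕ ! B ↓Ku∘
(A ⊸ B) ↓Ku∘ = ! A ↓Ku∘ ⊸ B ↓Ku∘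
(∀′ A)  ↓Ku∘ = ∀′ ？ ! A ↓Ku∘
(∃′ A)  ↓Ku∘ = ∃′ ! A ↓Ku∘
(! A)   ↓Ku∘ = ! A ↓Ku∘

{-# OPTIONS --safe #-}
module Submission where

open import Defs
open import Data.List.Base using ([]; _∷_; [_])
open import Data.List.Relation.Binary.Permutation.Propositional using (↭-swap; ↭-refl)
open import Data.Maybe.Base using (just)
open import Data.Nat.Base using (zero; suc)
open import Data.Product.Base using (∃-syntax; _×_; _,_)
open import Data.Vec.Base using (Vec; []; _∷_)
open import Function.Base using (_∘_)
open import Relation.Binary.PropositionalEquality using (_≡_; refl; sym; cong; cong₂; subst)

-- The formula (A ^Ku) ^∘ is literally ! ？ ! (A ↓Ku ↓∘), and A ↓Ku ↓∘ differs
-- from A ↓Ku∘ only in that the latter has extra !'s under &.  These are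
-- absorbed by an outer !, so by induction on A each of the two formulas
-- follows from the ! of the other.

-- σ is a renaming with left inverse τ.  Unlike the pointwise composite of two
-- arbitrary substitutions, this passes under lift without composition lemmas.
LeftInverse : ∀ {L} → Subst L → Subst L → Set
LeftInverse τ σ = ∀ i → ∃[ j ] (σ i ≡ var j × τ j ≡ var i)

-- As `σ i` is a variable `var j`, its shift is `var (suc j)`, where `lift τ` is the shift of `τ j`;
-- so both equations at `suc i` are shifts of those at `i`.
lift-leftInverse : ∀ {L} {τ σ : Subst L} → LeftInverse τ σ → LeftInverse (lift τ) (lift σ)
lift-leftInverse inv zero = zero , refl , refl
lift-leftInverse inv (suc i) with inv i
... | j , σi≡j , τj≡i = suc j , cong (subT (var ∘ suc)) σi≡j , cong (subT (var ∘ suc)) τj≡i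

mutual
  subT-inverse : ∀ {L} {τ σ : Subst L} → LeftInverse τ σ → ∀ t → subT τ (subT σ t) ≡ t
  subT-inverse inv (var i) with inv i
  ... | j , σi≡j , τj≡i rewrite σi≡j = τj≡i
  subT-inverse inv (fun f ts) = cong (fun f) (subTs-inverse inv ts)

  subTs-inverse : ∀ {L n} {τ σ : Subst L} → LeftInverse τ σ →
                  (ts : Vec (Term L) n) → subTs τ (subTs σ ts) ≡ ts
  subTs-inverse inv []       = refl
  subTs-inverse inv (t ∷ ts) = cong₂ _∷_ (subT-inverse inv t) (subTs-inverse inv ts)

subA-inverse : ∀ {L} {τ σ : Subst L} → LeftInverse τ σ → ∀ P → subA τ (subA σ P) ≡ P
subA-inverse inv (rel R ts) = cong (rel R) (subTs-inverse inv ts)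
subA-inverse inv 𝟏 = refl
subA-inverse inv ⊤ = refl
subA-inverse inv 𝟎 = refl
subA-inverse inv ⊥ = refl

subF-inverse : ∀ {L} {τ σ : Subst L} → LeftInverse τ σ → ∀ A → subF τ (subF σ A) ≡ A
subF-inverse inv (atom P) = cong atom (subA-inverse inv P)
subF-inverse inv (A ⊗ B)  = cong₂ _⊗_ (subF-inverse inv A) (subF-inverse inv B)
subF-inverse inv (A & B)  = cong₂ _&_ (subF-inverse inv A) (subF-inverse inv B)
subF-inverse inv (A ⊕ B)  = cong₂ _⊕_ (subF-inverse inv A) (subF-inverse inv B)
subF-inverse inv (A ⊸ B)  = cong₂ _⊸_ (subF-inverse inv A) (subF-inverse inv B)
subF-inverse inv (∀′ A)   = cong ∀′_ (subF-inverse (lift-leftInverse inv) A)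
subF-inverse inv (∃′ A)   = cong ∃′_ (subF-inverse (lift-leftInverse inv) A)
subF-inverse inv (! A)    = cong !_ (subF-inverse inv A)

-- The left-hand side is the body of weaken (∀′ A) or weaken (∃′ A),
-- instantiated at the eigenvariable.
weaken-body-instance : ∀ {L} (A : Formula L) → subF (lift (var ∘ suc)) A ⟦ var 0 ⟧ ≡ A
weaken-body-instance = subF-inverse λ
  -- Here `τ` is `single (var 0)`: it fixes index 0 and lowers every other index by one.
  { zero    → zero , refl , refl
  ; (suc i) → suc (suc i) , refl , refl }

module _ {L : Signature} {T : AxiomSet L} where

  infix 3 _⇒_ _!⇒_
  _⇒_ _!⇒_ : Formula L → Formula L → Set
  A ⇒ B  = T ▷ [ A ] ⊢ just B
  A !⇒ B = ! A ⇒ B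

  variable
    A B C D : Formula L

  !-promote : A !⇒ B → ! A ⇒ ! B
  !-promote {A} = !R {Γ = [ A ]}

  ⊗-mono : A ⇒ B → C ⇒ D → A ⊗ C ⇒ B ⊗ D
  ⊗-mono f g = ⊗L (⊗R f g)

  ⊕-mono : A ⇒ B → C ⇒ D → A ⊕ C ⇒ B ⊕ D
  ⊕-mono f g = ⊕L (⊕R₁ f) (⊕R₂ g)

  &-mono : A ⇒ B → C ⇒ D → A & C ⇒ B & D
  &-mono f g = &R (&L₁ f) (&L₂ g)

  ⊸-mono : A ⇒ B → C ⇒ D → B ⊸ C ⇒ A ⊸ D
  ⊸-mono f g = ⊸R (exch (↭-swap _ _ ↭-refl) (⊸L f g))

  ¬-anti : A ⇒ B → ¬ B ⇒ ¬ A
  ¬-anti f = ⊸-mono f id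

  ？-mono : A ⇒ B → ？ A ⇒ ？ B
  ？-mono f = ¬-anti (!-promote (!L (¬-anti f)))

  ∀-mono : A ⇒ B → ∀′ A ⇒ ∀′ B
  ∀-mono {A} {B} f =
    ∀R (∀L (var 0) (subst (_⇒ B) (sym (weaken-body-instance A)) f))

  ∃-mono : A ⇒ B → ∃′ A ⇒ ∃′ B
  ∃-mono {A} {B} f =
    ∃L (∃R (var 0) (subst (A ⇒_) (sym (weaken-body-instance B)) f))

  -- `g` consumes `! C`, not `C`. Promotion supplies it because the whole context is banged: the
  -- antecedent is `! A`, and the implication itself stands under `!`.
  !⊸-mono : A !⇒ B → C !⇒ D → ! B ⊸ C !⇒ ! A ⊸ D
  !⊸-mono {A} {B} {C} f g = ⊸R (cut (!R {Γ = A ∷ (! B ⊸ C) ∷ []} apply) g)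
    where
    apply : T ▷ ! A ∷ ! (! B ⊸ C) ∷ [] ⊢ just C
    apply = exch (↭-swap _ _ ↭-refl) (!L (⊸L (!-promote f) id))

  -- `&R` shares its context, so each branch has the whole `! (A & C)` and can project under
  -- promotion.
  !&-absorb : A !⇒ B → C !⇒ D → A & C !⇒ ! B & ! D
  !&-absorb f g = &R (!-promote (cut (!-promote (!L (&L₁ id))) f))
                     (!-promote (cut (!-promote (!L (&L₂ id))) g))

  Ku∘-equivalent : ∀ A → (A ↓Ku ↓∘ !⇒ A ↓Ku∘) × (A ↓Ku∘ !⇒ A ↓Ku ↓∘)
  Ku∘-equivalent (atom P) = !L id , !L id
  Ku∘-equivalent (A ⊗ B) with Ku∘-equivalent A | Ku∘-equivalent B
  ... | a , a′ | b , b′ = !L (⊗-mono (!-promote a) (!-promote b))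
                        , !L (⊗-mono (!-promote a′) (!-promote b′))
  -- Backwards, the components already carry the `!` that `a′` and `b′` consume.
  Ku∘-equivalent (A & B) with Ku∘-equivalent A | Ku∘-equivalent B
  ... | a , a′ | b , b′ = !&-absorb a b , !L (&-mono a′ b′)
  Ku∘-equivalent (A ⊕ B) with Ku∘-equivalent A | Ku∘-equivalent B
  ... | a , a′ | b , b′ = !L (⊕-mono (!-promote a) (!-promote b))
                        , !L (⊕-mono (!-promote a′) (!-promote b′))
  -- Contravariance on the left uses the opposite direction for `A`, so both directions are proved
  -- together.
  Ku∘-equivalent (A ⊸ B) with Ku∘-equivalent A | Ku∘-equivalent B
  ... | a , a′ | b , b′ = !⊸-mono a′ b , !⊸-mono a b′
  -- `(¬ ¬ A ↓Ku) ↓∘` unfolds to `？ ! (A ↓Ku ↓∘)`, so both bodies have the prefix `？ !`.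
  Ku∘-equivalent (∀′ A) with Ku∘-equivalent A
  ... | a , a′ = !L (∀-mono (？-mono (!-promote a))) , !L (∀-mono (？-mono (!-promote a′)))
  Ku∘-equivalent (∃′ A) with Ku∘-equivalent A
  ... | a , a′ = !L (∃-mono (!-promote a)) , !L (∃-mono (!-promote a′))
  Ku∘-equivalent (! A) with Ku∘-equivalent A
  ... | a , a′ = !L (!-promote a) , !L (!-promote a′)

  -- The innermost `!` of the prefix is the one that `f` consumes.
  !？!-mono : A !⇒ B → ! ？ ! A ⇒ ! ？ ! B
  !？!-mono f = !-promote (!L (？-mono (!-promote f)))

theorem3 : (L : Signature) (A : Formula L) →
    ProvablyEquivalent CLLb ((A ^Ku) ^∘) (! ？ ! (A ↓Ku∘))
theorem3 L A with Ku∘-equivalent A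
... | a , a′ = &R (⊸R (!？!-mono a)) (⊸R (!？!-mono a′))
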